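{- For every integer $m\geq 4$, every graph with chromatic number at least $m+1$ has a $3$-connected subgraph with chromatic number at least $m$. In particular (since a fragile graph has no 3-connected subgraph), every fragile graph is $4$-colourable.
   Context: All graphs are finite and simple. A graph is $k$-connected if it has at least $k+1$ vertices and no vertex cutset with at most $k-1$ vertices. A graph is fragile if it has no $3$-connected subgraph. -}

module Defs where

open import Data.Fin.Base using (Fin; zero; finToFun; funToFin)
open import Data.Fin.Properties using (any?; all?; finToFun-funToFin)
open import Data.Fin.Properties as Fin using ()
open import Data.Fin.Subset using (Subset; _∈_; _∉_; _⊆_; _─_; ∣_∣)
open import Data.Fin.Subset.Properties using (_∈?_; nonempty?; x∈p∧x∉q⇒x∈p─q)
open import Data.Nat.Base using (ℕ; zero; suc; _≤_; _<_; z≤n; s≤s)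
open import Data.Product.Base using (Σ; ∃; ∃-syntax; _×_; _,_; proj₁; proj₂)
open import Data.Vec.Properties.WithK using ([]=-irrelevant)
open import Function.Base using (_∘_)
open import Level using (0ℓ)
open import Relation.Binary.Core using (Rel; _⇒_)
open import Relation.Binary.Definitions using (Decidable; Symmetric; Irreflexive)
open import Relation.Binary.Construct.Closure.ReflexiveTransitive using (Star)
open import Relation.Binary.PropositionalEquality
  using (_≡_; _≢_; refl; sym; trans; cong; subst)
open import Relation.Nullary using (¬_; Dec; yes; no; contradiction)
open import Relation.Nullary.Decidable using (map′; ¬?; _×-dec_; _→-dec_)
import Relation.Unary as U

-- A finite simple graph whose vertex set is an arbitrary set of labels from
-- Fin n, so that a graph and all its subgraphs live in the same type.  The
-- number of vertices is ∣ V ∣, which may be smaller than n.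
record Graph (n : ℕ) : Set₁ where
  field
    V      : Subset n
    Adj    : Rel (Fin n) 0ℓ
    adj?   : Decidable Adj
    adj-∈  : ∀ {x y} → Adj x y → x ∈ V
    symm   : Symmetric Adj
    irrefl : Irreflexive _≡_ Adj

open Graph public

private
  variable
    n : ℕ

Vertex : Graph n → Set
Vertex G = ∃[ v ] v ∈ V G

infix 4 _⊑_

-- Subgraphs need not be induced.
_⊑_ : Graph n → Graph n → Set
H ⊑ G = (V H ⊆ V G) × (Adj H ⇒ Adj G)

infixl 5 _∖_

_∖_ : Graph n → Subset n → Graph n
G ∖ X = record
  { V      = V G ─ X
  ; Adj    = λ x y → Adj G x y × x ∉ X × y ∉ X
  ; adj?   = λ x y → adj? G x y ×-dec (¬? (x ∈? X) ×-dec ¬? (y ∈? X))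
  ; adj-∈  = λ (a , x∉ , _) → x∈p∧x∉q⇒x∈p─q (adj-∈ G a) x∉
  ; symm   = λ (a , x∉ , y∉) → symm G a , y∉ , x∉
  ; irrefl = λ eq (a , _) → irrefl G eq a
  }

Connected : Graph n → Set
Connected G = ∀ {x y} → x ∈ V G → y ∈ V G → Star (Adj G) x y

Cutset : Graph n → Subset n → Set
Cutset G X = (X ⊆ V G) × ¬ Connected (G ∖ X)

infix 4 _-Connected_

_-Connected_ : ℕ → Graph n → Set
k -Connected G = (suc k ≤ ∣ V G ∣) × ¬ (∃[ X ] Cutset G X × ∣ X ∣ < k)

Fragile : Graph n → Set₁
Fragile G = ¬ (∃[ H ] H ⊑ G × 3 -Connected H)

Proper : (G : Graph n) {k : ℕ} → (Vertex G → Fin k) → Set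
Proper G c = ∀ u v → Adj G (proj₁ u) (proj₁ v) → c u ≢ c v

infix 4 _-Colourable_

_-Colourable_ : ℕ → Graph n → Set
k -Colourable G = Σ (Vertex G → Fin k) (Proper G)

IsChromaticNumber : Graph n → ℕ → Set
IsChromaticNumber G k = k -Colourable G × (∀ j → j -Colourable G → k ≤ j)

least : {P : ℕ → Set} → U.Decidable P → ∀ b → P b →
        ∃[ k ] P k × (∀ j → P j → k ≤ j)
least P? b pb with P? zero
least P? b       pb | yes p0 = zero , p0 , λ _ _ → z≤n
least P? zero    pb | no ¬p0 = contradiction pb ¬p0
least {P} P? (suc b) pb | no ¬p0 with least (P? ∘ suc) b pb
... | k , pk , min = suc k , pk , λ where
  zero    p0 → contradiction p0 ¬p0
  (suc j) pj → s≤s (min j pj)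

module _ (G : Graph n) where

  vertex-≡ : {u v : Vertex G} → proj₁ u ≡ proj₁ v → u ≡ v
  vertex-≡ {x , p} {.x , q} refl = cong (x ,_) ([]=-irrelevant p q)

  -- For k > 0 a colouring extends to all of Fin n, and the functions
  -- Fin n → Fin k can be enumerated.
  ProperOn : ∀ {k} → (Fin n → Fin k) → Set
  ProperOn f = ∀ x y → Adj G x y → f x ≢ f y

  properOn? : ∀ {k} (f : Fin n → Fin k) → Dec (ProperOn f)
  properOn? f = all? λ x → all? λ y → adj? G x y →-dec ¬? (f x Fin.≟ f y)

  extend : ∀ {k} → (Vertex G → Fin (suc k)) → Fin n → Fin (suc k)
  extend c x with x ∈? V G
  ... | yes p = c (x , p)
  ... | no  _ = zero

  extend-∈ : ∀ {k} (c : Vertex G → Fin (suc k)) (u : Vertex G) →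
             extend c (proj₁ u) ≡ c u
  extend-∈ c (x , p) with x ∈? V G
  ... | yes q = cong c (vertex-≡ refl)
  ... | no ¬p = contradiction p ¬p

  colourable? : ∀ k → Dec (k -Colourable G)
  colourable? zero with nonempty? (V G)
  ... | yes v = no λ (c , _) → Fin.¬Fin0 (c v)
  ... | no ¬v = yes ((λ v → contradiction v ¬v) , λ u → contradiction u ¬v)
  colourable? (suc k) =
    map′ to from (any? λ i → properOn? (finToFun {suc k} {n} i))
    where
    to : ∃ (λ i → ProperOn (finToFun {suc k} {n} i)) → suc k -Colourable G
    to (i , p) = finToFun i ∘ proj₁ , λ u v → p (proj₁ u) (proj₁ v)

    from : suc k -Colourable G → ∃ (λ i → ProperOn (finToFun {suc k} {n} i))
    from (c , p) = funToFin (extend c) , λ x y a eq →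
      let u = x , adj-∈ G a
          v = y , adj-∈ G (symm G a)
          val = λ w → trans (finToFun-funToFin (extend c) (proj₁ w)) (extend-∈ c w)
      in p u v a (trans (sym (val u)) (trans eq (val v)))

  n-colourable : n -Colourable G
  n-colourable = proj₁ , λ _ _ a eq → irrefl G eq a

chromaticNumber : (G : Graph n) → ∃ (IsChromaticNumber G)
chromaticNumber {n} G = least (colourable? G) n (n-colourable G)

χ : Graph n → ℕ
χ G = proj₁ (chromaticNumber G)

{-# OPTIONS --safe #-}
-- Let m = k + 1 ≥ 4 and suppose that every 3-connected subgraph of G is k-colourable.
-- A k-colourable graph has m-colourings in which any prescribed independent set has a
-- colour of its own.  Three consequences of this, collected in `Flexible`, survive gluing
-- two graphs along a 2-vertex cut {p , q}: two nonadjacent vertices can get the same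
-- colour, one vertex can get a colour different from those of two others, and three
-- independent vertices can use exactly two colours.  Every induced subgraph of G is thus
-- m-colourable, by induction: it is 3-connected, or has at most 3 vertices, or is such a
-- gluing of smaller ones.
--
-- Colourings f and g of the two sides combine as soon as they agree on whether p and q
-- have the same colour, since the colours of g can be permuted; the permutation can also
-- give one further vertex d of the second side any colour that relates to those of p and q
-- as g d does.
module Submission where

open import Defs
open import Data.Nat.Base using (ℕ; _+_; _≤_; _≥_)
open import Data.Product.Base using (∃-syntax; _×_)
open import Data.Fin.Base using (Fin; zero; suc; inject≤; punchIn; punchOut)
open import Data.Fin.Patterns using (0F; 1F; 2F; 3F)
open import Data.Fin.Permutation.Components using (transpose; transpose-inverse)
open import Data.Fin.Properties
  using ( _≟_; any?; all?; pigeonhole; <⇒≢; suc-injective; 0≢1+n; inject≤-injective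
        ; punchIn-punchOut)
open import Data.Fin.Subset
  using (Subset; inside; outside; _∈_; _∉_; _⊆_; _⊂_; _∪_; _∩_; _─_; ∁; ⁅_⁆; ⊤; ⊥; ∣_∣)
open import Data.Fin.Subset.Induction using (⊂-wellFounded; ⊃-wellFounded; Acc; acc)
open import Data.Fin.Subset.Properties
  using ( _∈?_; _⊆?_; anySubset?; nonempty?; ∉⊥; ∣⊤∣≡n; x∈⁅x⁆; x∈⁅y⁆⇒x≡y
        ; x∈p∪q⁺; x∈p∪q⁻; p⊆p∪q
        ; x∈p∩q⁺; x∈p∩q⁻; p∩q⊆p; p─q⊆p; x∈∁p⇒x∉p; x∉p⇒x∈∁p )
open import Data.List.Base using (List; []; _∷_)
open import Data.List.Relation.Unary.All as All using (All; []; _∷_)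
open import Data.List.Relation.Unary.AllPairs using (AllPairs; []; _∷_)
open import Data.Nat.Base using (zero; suc; _<_; s≤s)
open import Data.Nat.Properties as ℕ using (_<?_; ≮⇒≥; ≰⇒>)
open import Data.Product.Base using (_,_; proj₁; proj₂)
open import Data.Sum.Base as Sum using (_⊎_; inj₁; inj₂; swap; [_,_]′)
open import Data.Vec.Base using ([]; _∷_; here; there; lookup)
open import Function.Base using (_∘_; id; flip)
open import Function.Definitions using (Injective)
open import Relation.Binary.Construct.Closure.ReflexiveTransitive using (Star; ε; _◅_; _◅◅_)
open import Relation.Binary.PropositionalEquality
  using (_≡_; _≢_; refl; sym; trans; cong; subst; subst₂; ≢-sym)
open import Relation.Nullary using (¬_; Dec; yes; no; contradiction)
open import Relation.Nullary.Decidable using (¬?; _×-dec_; _⊎-dec_; decidable-stable)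

private
  variable
    n m j : ℕ

-- Finite sets and colours

enum : (p : Subset n) → Fin ∣ p ∣ → Fin n
enum (inside  ∷ p) zero    = zero
enum (inside  ∷ p) (suc i) = suc (enum p i)
enum (outside ∷ p) i       = suc (enum p i)

enum-∈ : (p : Subset n) (i : Fin ∣ p ∣) → enum p i ∈ p
enum-∈ (inside  ∷ p) zero    = here
enum-∈ (inside  ∷ p) (suc i) = there (enum-∈ p i)
enum-∈ (outside ∷ p) i       = there (enum-∈ p i)

enum-injective : (p : Subset n) → Injective _≡_ _≡_ (enum p)
enum-injective (inside  ∷ p) {zero}  {zero}  _  = refl
enum-injective (inside  ∷ p) {suc i} {suc l} eq = cong suc (enum-injective p (suc-injective eq))
enum-injective (outside ∷ p)                 eq = enum-injective p (suc-injective eq)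

enum-onto : (p : Subset n) {x : Fin n} → x ∈ p → ∃[ i ] enum p i ≡ x
enum-onto (inside  ∷ p) here      = zero , refl
enum-onto (inside  ∷ p) (there x∈p) with i , eq ← enum-onto p x∈p = suc i , cong suc eq
enum-onto (outside ∷ p) (there x∈p) with i , eq ← enum-onto p x∈p = i , cong suc eq

injection⇒≤∣∣ : (p : Subset n) (t : Fin j → Fin n) → Injective _≡_ _≡_ t →
                (∀ i → t i ∈ p) → j ≤ ∣ p ∣
injection⇒≤∣∣ {j = j} p t inj t∈p = ≮⇒≥ λ lt →
  let i , l , i<l , eq = pigeonhole lt (proj₁ ∘ enum-onto p ∘ t∈p)
      at = proj₂ ∘ enum-onto p ∘ t∈p
  in <⇒≢ i<l (inj (trans (sym (at i)) (trans (cong (enum p) eq) (at l))))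

-- If every element of `p` were a value of `t`, picking an index for each would inject `∣ p ∣`
-- positions into `Fin j`.
avoiding : (p : Subset n) (t : Fin j → Fin n) → j < ∣ p ∣ →
           ∃[ x ] x ∈ p × (∀ i → x ≢ t i)
avoiding p t j<∣p∣ with any? (λ x → (x ∈? p) ×-dec all? λ i → ¬? (x ≟ t i))
... | yes found = found
... | no  none  =
  let a , b , a<b , eq = pigeonhole j<∣p∣ (proj₁ ∘ hit)
      at = proj₂ ∘ hit
  in contradiction (enum-injective p (trans (at a) (trans (cong t eq) (sym (at b))))) (<⇒≢ a<b)
  where
  hit : ∀ a → ∃[ i ] enum p a ≡ t i
  hit a = decidable-stable (any? λ i → enum p a ≟ t i)
    λ miss → none (enum p a , enum-∈ p a , λ i eq → miss (i , eq))

fresh : (c : Fin j → Fin m) → j < m → ∃[ e ] ∀ i → e ≢ c i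
fresh {m = m} c j<m
  with e , _ , new ← avoiding ⊤ c (subst (_ <_) (sym (∣⊤∣≡n m)) j<m) = e , new

-- Permuting colours

data Alike (a b : Fin m) (a′ b′ : Fin j) : Set where
  equal  : a ≡ b → a′ ≡ b′ → Alike a b a′ b′
  differ : a ≢ b → a′ ≢ b′ → Alike a b a′ b′

transpose-injective : (a b : Fin m) → Injective _≡_ _≡_ (transpose a b)
transpose-injective a b eq =
  trans (sym (transpose-inverse b a)) (trans (cong (transpose b a) eq) (transpose-inverse b a))

transpose-left : (a b : Fin m) → transpose a b a ≡ b
transpose-left a b with a ≟ a
... | yes _  = refl
... | no a≢a = contradiction refl a≢a

transpose-other : (a b : Fin m) {c : Fin m} → c ≢ a → c ≢ b → transpose a b c ≡ c
transpose-other a b {c} c≢a c≢b with c ≟ a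
... | yes c≡a = contradiction c≡a c≢a
... | no _ with c ≟ b
...   | yes c≡b = contradiction c≡b c≢b
...   | no _    = refl

-- A partial map that preserves and reflects equality extends to a permutation of the colours. It is
-- built pair by pair, each time composing with the transposition that moves the current image of
-- `a` to its target `b`.
relabel : {ps : List (Fin m × Fin m)} →
          AllPairs (λ (a , b) (a′ , b′) → Alike b b′ a a′) ps →
          ∃[ τ ] Injective _≡_ _≡_ τ × All (λ (a , b) → τ a ≡ b) ps
relabel [] = id , id , []
relabel {ps = (a , b) ∷ ps} (alike ∷ rest) with relabel rest
... | τ , inj , at with τ a ≟ b
...   | yes τa≡b = τ , inj , τa≡b ∷ at
...   | no  τa≢b =
  transpose (τ a) b ∘ τ , inj ∘ transpose-injective (τ a) b ,
  transpose-left (τ a) b ∷ All.zipWith (λ { (r , eq) → keep r eq }) (alike , at)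
  where
  -- Pairs treated earlier survive the transposition. If their target were `b`, their source would
  -- be `a` and `τ a` would already be `b`; otherwise `b′` differs from `b` and, by injectivity,
  -- from `τ a`, so it is fixed.
  keep : ∀ {a′ b′} → Alike b b′ a a′ → τ a′ ≡ b′ → transpose (τ a) b (τ a′) ≡ b′
  keep (equal b≡b′ a≡a′) eq = contradiction (trans (cong τ a≡a′) (trans eq (sym b≡b′))) τa≢b
  keep (differ b≢b′ a≢a′) eq = trans
    (transpose-other (τ a) b (λ τ≡ → a≢a′ (sym (inj τ≡))) (λ τ≡b → b≢b′ (trans (sym τ≡b) eq)))
    eq

≢-transʳ : ∀ {A : Set} {a b c : A} → a ≢ b → b ≡ c → a ≢ c
≢-transʳ a≢b refl = a≢b

data TwoTone {m} (a b c : Fin m) : Set where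
  lone₁ : b ≡ c → a ≢ b → TwoTone a b c
  lone₂ : a ≡ c → b ≢ a → TwoTone a b c
  lone₃ : a ≡ b → c ≢ a → TwoTone a b c

rotate : {a b c : Fin m} → TwoTone a b c → TwoTone b c a
rotate (lone₁ e d) = lone₃ e d
rotate (lone₂ e d) = lone₁ (sym e) (≢-transʳ d e)
rotate (lone₃ e d) = lone₂ (sym e) (≢-transʳ d e)

reflect : {a b c : Fin m} → TwoTone a b c → TwoTone a c b
reflect (lone₁ e d) = lone₁ (sym e) (≢-transʳ d e)
reflect (lone₂ e d) = lone₃ e d
reflect (lone₃ e d) = lone₂ e d

TwoTone-resp : {a a′ b b′ c c′ : Fin m} → a ≡ a′ → b ≡ b′ → c ≡ c′ →
               TwoTone a b c → TwoTone a′ b′ c′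
TwoTone-resp refl refl refl t = t

-- Gluing along a cut of two vertices

-- Colourings are total on `Fin n` and constrained only on `U`, so colourings of overlapping vertex
-- sets can be compared without membership proofs.
ProperWithin : Graph n → Subset n → (Fin n → Fin m) → Set
ProperWithin G U f = ∀ {x y} → x ∈ U → y ∈ U → Adj G x y → f x ≢ f y

-- Colourings use `suc k` colours, at least four. The clique hypothesis reflects that K₄ is itself
-- 3-connected, hence `k`-colourable; it enters through `spare`.
module Flexibility {n} (G : Graph n) (k : ℕ) (3≤k : 3 ≤ k)
  (clique⇒4≤k : (t : Fin 4 → Fin n) → (∀ i l → i ≢ l → Adj G (t i) (t l)) → 4 ≤ k)
  where

  ProperIn : Subset n → (Fin n → Fin (suc k)) → Set
  ProperIn = ProperWithin G

  record Independent (x y : Fin n) : Set where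
    constructor independent
    field
      distinct : x ≢ y
      nonadj   : ¬ Adj G x y

  independent-sym : ∀ {x y} → Independent x y → Independent y x
  independent-sym (independent x≢y ¬xy) = independent (≢-sym x≢y) (¬xy ∘ symm G)

  Joined : Subset n → Fin n → Fin n → Set
  Joined U u v = ∃[ h ] ProperIn U h × h u ≡ h v

  Separated : Subset n → Fin n → Fin n → Fin n → Set
  Separated U u v w = ∃[ h ] ProperIn U h × h u ≢ h v × h u ≢ h w

  TwoToned : Subset n → Fin n → Fin n → Fin n → Set
  TwoToned U u v w = ∃[ h ] ProperIn U h × TwoTone (h u) (h v) (h w)

  -- Coincidences are allowed on purpose: `same` with `x` equal to `y` just yields a proper
  -- colouring, and `apart` with `y` equal to `z` separates a single pair.
  record Flexible (U : Subset n) : Set where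
    field
      same    : ∀ {x y} → x ∈ U → y ∈ U → ¬ Adj G x y → Joined U x y
      apart   : ∀ {x y z} → x ∈ U → y ∈ U → z ∈ U → x ≢ y → x ≢ z → Separated U x y z
      twoTone : ∀ {x y z} → x ∈ U → y ∈ U → z ∈ U →
                Independent x y → Independent x z → Independent y z → TwoToned U x y z

  open Flexible

  -- Either two of the four vertices are nonadjacent and can share a colour, or they form a
  -- 3-connected K₄ and there are at least five colours.
  spare : ∀ {U} → Flexible U → (t : Fin 4 → Fin n) → (∀ i → t i ∈ U) →
          ∃[ f ] ProperIn U f × ∃[ e ] ∀ i → e ≢ f (t i)
  spare F t t∈U with any? (λ i → any? λ l → ¬? (i ≟ l) ×-dec ¬? (adj? G (t i) (t l)))
  ... | no  complete =
    let edge = λ i l i≢l → decidable-stable (adj? G (t i) (t l)) λ ¬a → complete (i , l , i≢l , ¬a)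
        0≢1 = λ eq → irrefl G eq (edge 0F 1F λ ())
        f , pf , _ = apart F (t∈U 0F) (t∈U 1F) (t∈U 1F) 0≢1 0≢1
    in f , pf , fresh (f ∘ t) (s≤s (clique⇒4≤k t edge))
  ... | yes (i , l , i≢l , ¬a)
    with f , pf , eq ← same F (t∈U i) (t∈U l) ¬a
    -- Since `t l` has the colour of `t i`, it suffices to avoid the three vertices other than
    -- `t l`, and there are at least four colours.
    with e , new ← fresh (f ∘ t ∘ punchIn l) (s≤s 3≤k) = f , pf , e , new′
    where
    hit : ∀ x → l ≢ x → e ≢ f (t x)
    hit x l≢x = subst (λ y → e ≢ f (t y)) (punchIn-punchOut l≢x) (new (punchOut l≢x))
    new′ : ∀ x → e ≢ f (t x)
    new′ x with l ≟ x
    ... | no  l≢x  = hit x l≢x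
    ... | yes refl = subst (e ≢_) eq (hit i (≢-sym i≢l))

  record Gluing (U : Subset n) : Set where
    field
      A B       : Subset n
      p q       : Fin n
      p∈A       : p ∈ A
      q∈A       : q ∈ A
      p∈B       : p ∈ B
      q∈B       : q ∈ B
      p≢q       : p ≢ q
      cover     : ∀ {x} → x ∈ U → x ∈ A ⊎ x ∈ B
      common    : ∀ {x} → x ∈ A → x ∈ B → x ≡ p ⊎ x ≡ q
      -- No edge joins A ∖ B to B ∖ A.
      separated : ∀ {x y} → x ∈ A → y ∈ B → Adj G x y → y ∈ A ⊎ x ∈ B
      flexA     : Flexible A
      flexB     : Flexible B

  -- Interchanging the two sides, and below the two cut vertices, are the symmetries that halve the
  -- later case distinctions.
  mirror : ∀ {U} → Gluing U → Gluing U
  mirror S = record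
    { A = B ; B = A ; p = p ; q = q ; p∈A = p∈B ; q∈A = q∈B ; p∈B = p∈A ; q∈B = q∈A
    ; p≢q = p≢q ; cover = swap ∘ cover ; common = flip common
    ; separated = λ x∈ y∈ xy → swap (separated y∈ x∈ (symm G xy))
    ; flexA = flexB ; flexB = flexA }
    where open Gluing S

  exchange : ∀ {U} → Gluing U → Gluing U
  exchange S = record
    { A = A ; B = B ; p = q ; q = p ; p∈A = q∈A ; q∈A = p∈A ; p∈B = q∈B ; q∈B = p∈B
    ; p≢q = ≢-sym p≢q ; cover = cover ; common = λ x∈A x∈B → swap (common x∈A x∈B)
    ; separated = separated ; flexA = flexA ; flexB = flexB }
    where open Gluing S

  module Glue {U} (S : Gluing U) where
    open Gluing S public

    Extends : (f h : Fin n → Fin (suc k)) → Set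
    Extends f h = ∀ {x} → x ∈ A → h x ≡ f x

    ≢-extends : ∀ {f h x y} → Extends f h → x ∈ A → y ∈ A → f x ≢ f y → h x ≢ h y
    ≢-extends ext x∈ y∈ = subst₂ _≢_ (sym (ext x∈)) (sym (ext y∈))

    ∉A⇒≢ : ∀ {x y} → x ∉ A → y ∈ A → x ≢ y
    ∉A⇒≢ x∉A y∈A refl = x∉A y∈A

    -- On `A` the result is `f`, elsewhere it is `g` followed by the permutation sending `g d`,
    -- `g p`, `g q` to `c`, `f p`, `f q`. Inequalities of `g` survive because the permutation is
    -- injective. Taking `p` for `d` and `f p` for `c` prescribes nothing extra.
    glue : ∀ {f g d c} → ProperIn A f → ProperIn B g → Alike (f p) (f q) (g p) (g q) →
           d ∈ B → Alike c (f p) (g d) (g p) → Alike c (f q) (g d) (g q) →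
           ∃[ h ] ProperIn U h × Extends f h × h d ≡ c ×
                  (∀ {x y} → x ∈ B → y ∈ B → g x ≢ g y → h x ≢ h y)
    glue {f} {g} {d} {c} pf pg pq d∈B dp dq
      with relabel ((dp ∷ dq ∷ []) ∷ (pq ∷ []) ∷ [] ∷ [])
    ... | τ , inj , τd ∷ τp ∷ τq ∷ [] =
      h , proper , onA , trans (onB d∈B) τd ,
      λ x∈B y∈B ne eq → ne (inj (trans (sym (onB x∈B)) (trans eq (onB y∈B))))
      where
      h : Fin n → Fin (suc k)
      h x with x ∈? A
      ... | yes _ = f x
      ... | no  _ = τ (g x)

      onA : Extends f h
      onA {x} x∈A with x ∈? A
      ... | yes _   = refl
      ... | no  x∉A = contradiction x∈A x∉A

      onB : ∀ {x} → x ∈ B → h x ≡ τ (g x)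
      onB {x} x∈B with x ∈? A
      ... | no  _   = refl
      ... | yes x∈A with common x∈A x∈B
      ...   | inj₁ refl = sym τp
      ...   | inj₂ refl = sym τq

      inA : ∀ {x y} → x ∈ A → y ∈ A → Adj G x y → h x ≢ h y
      inA x∈ y∈ xy = ≢-extends onA x∈ y∈ (pf x∈ y∈ xy)

      inB : ∀ {x y} → x ∈ B → y ∈ B → Adj G x y → h x ≢ h y
      inB x∈ y∈ xy = subst₂ _≢_ (sym (onB x∈)) (sym (onB y∈)) (pg x∈ y∈ xy ∘ inj)

      proper : ProperIn U h
      proper x∈U y∈U xy with cover x∈U | cover y∈U
      ... | inj₁ x∈A | inj₁ y∈A = inA x∈A y∈A xy
      ... | inj₂ x∈B | inj₂ y∈B = inB x∈B y∈B xy
      ... | inj₁ x∈A | inj₂ y∈B =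
        [ (λ y∈A → inA x∈A y∈A xy) , (λ x∈B → inB x∈B y∈B xy) ]′ (separated x∈A y∈B xy)
      ... | inj₂ x∈B | inj₁ y∈A =
        [ (λ x∈A → inA x∈A y∈A xy) , (λ y∈B → inB x∈B y∈B xy) ]′
        (separated y∈A x∈B (symm G xy))

    -- If `f` identifies `p` and `q`, properness makes them nonadjacent, so `same` applies on the
    -- other side; otherwise `apart` does.
    match : ∀ {f} → ProperIn A f → ∃[ g ] ProperIn B g × Alike (f p) (f q) (g p) (g q)
    match {f} pf with f p ≟ f q
    ... | yes fp≡fq = let g , pg , gp≡gq = same flexB p∈B q∈B (λ pq → pf p∈A q∈A pq fp≡fq)
                      in g , pg , equal fp≡fq gp≡gq
    ... | no  fp≢fq = let g , pg , gp≢gq , _ = apart flexB p∈B q∈B q∈B p≢q p≢q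
                      in g , pg , differ fp≢fq gp≢gq

    extendA : ∀ {f} → ProperIn A f → ∃[ h ] ProperIn U h × Extends f h
    extendA pf =
      let g , pg , pq = match pf
          h , ph , ext , _ = glue pf pg pq p∈B (equal refl refl) pq
      in h , ph , ext

    -- If `g` gives `d` the colour of `p` or `q`, the glued colour of `d` is `f p` or `f q`, neither
    -- of which is `e`. Otherwise `d` may take any colour besides `f p` and `f q`, and a fourth
    -- colour leaves one different from `e`.
    extend-avoiding : ∀ {f g e d} → ProperIn A f → ProperIn B g → Alike (f p) (f q) (g p) (g q) →
                      d ∈ B → e ≢ f p → e ≢ f q →
                      ∃[ h ] ProperIn U h × Extends f h × h d ≢ e
    extend-avoiding {f} {g} {e} {d} pf pg pq d∈B e≢p e≢q with g d ≟ g p | g d ≟ g q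
    ... | yes d≡p | _ =
      let h , ph , ext , hd , _ = glue pf pg pq d∈B (equal refl d≡p) (alike-q pq)
      in h , ph , ext , λ eq → e≢p (trans (sym eq) hd)
      where
      alike-q : Alike (f p) (f q) (g p) (g q) → Alike (f p) (f q) (g d) (g q)
      alike-q = subst (λ z → Alike (f p) (f q) z (g q)) (sym d≡p)
    ... | no d≢p | yes d≡q =
      let h , ph , ext , hd , _ = glue pf pg pq d∈B (alike-p pq) (equal refl d≡q)
      in h , ph , ext , λ eq → e≢q (trans (sym eq) hd)
      where
      alike-p : Alike (f p) (f q) (g p) (g q) → Alike (f q) (f p) (g d) (g p)
      alike-p (equal a b)  = equal (sym a) (trans d≡q (sym b))
      alike-p (differ a b) = differ (≢-sym a) d≢p
    ... | no d≢p | no d≢q =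
      let c , new = fresh (lookup (f p ∷ f q ∷ e ∷ [])) (s≤s 3≤k)
          h , ph , ext , hd , _ = glue pf pg pq d∈B (differ (new 0F) d≢p) (differ (new 1F) d≢q)
      in h , ph , ext , λ eq → new 2F (trans (sym hd) eq)

  -- A common colour for vertices on opposite sides of the cut

  module SameAcross {U} (S : Gluing U) {u v} (u∈A : u ∈ Gluing.A S) (v∈B : v ∈ Gluing.B S)
    (u∉B : u ∉ Gluing.B S) (v∉A : v ∉ Gluing.A S) where
    open Glue S

    align : ∀ {f g} → ProperIn A f → ProperIn B g →
            Alike (f p) (f q) (g p) (g q) →
            Alike (f u) (f p) (g v) (g p) → Alike (f u) (f q) (g v) (g q) → Joined U u v
    align pf pg pq up uq =
      let h , ph , ext , hv , _ = glue pf pg pq v∈B up uq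
      in h , ph , trans (ext u∈A) (sym hv)

    -- The three colourings of `B` show `v`, `p`, `q` all different, all equal, and `v` paired with
    -- `p` only. One of these patterns is available for `u` in `A`: if `u` and `p` are adjacent,
    -- moving `q` apart from both gives the first; if not, giving them the same colour leads to the
    -- second or third.
    join-via-p : ∀ {g₁ g₂ g₃} →
      ProperIn B g₁ → g₁ p ≢ g₁ q → g₁ v ≢ g₁ p → g₁ v ≢ g₁ q →
      ProperIn B g₂ → g₂ p ≡ g₂ q → g₂ v ≡ g₂ p →
      ProperIn B g₃ → g₃ v ≡ g₃ p → g₃ q ≢ g₃ v → Joined U u v
    join-via-p {g₁} {g₂} {g₃} pg₁ p≢q₁ v≢p₁ v≢q₁ pg₂ p≡q₂ v≡p₂ pg₃ v≡p₃ q≢v₃ with adj? G u p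
    ... | yes up =
      let f , pf , q≢p , q≢u = apart flexA q∈A p∈A u∈A (≢-sym p≢q) (λ { refl → u∉B q∈B })
      in align pf pg₁ (differ (≢-sym q≢p) p≢q₁) (differ (pf u∈A p∈A up) v≢p₁)
               (differ (≢-sym q≢u) v≢q₁)
    ... | no ¬up with same flexA u∈A p∈A ¬up
    ...   | f , pf , u≡p with f p ≟ f q
    ...     | yes p≡q = align pf pg₂ (equal p≡q p≡q₂) (equal u≡p v≡p₂)
                              (equal (trans u≡p p≡q) (trans v≡p₂ p≡q₂))
    ...     | no  p≢q′ = align pf pg₃ (differ p≢q′ (≢-sym (≢-transʳ q≢v₃ v≡p₃)))
                               (equal u≡p v≡p₃)
                               (differ (λ u≡q → p≢q′ (trans (sym u≡p) u≡q)) (≢-sym q≢v₃))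

  -- As `f` identifies `p` and `q`, they are nonadjacent and `B` has a colouring identifying them
  -- too. If it separates `v` from them, it fits `f`. If not, `v`, `p`, `q` are independent, and a
  -- two-toned colouring either fits `f` with `v` alone or pairs `v` with one cut vertex, as
  -- `join-via-p` requires.
  join-mismatched : ∀ {U} (S : Gluing U) → let open Gluing S in
    ∀ {u v f g} → u ∈ A → v ∈ B → u ∉ B → v ∉ A →
    ProperIn A f → f p ≡ f q → f u ≢ f p →
    ProperIn B g → g p ≢ g q → g v ≢ g p → g v ≢ g q → Joined U u v
  join-mismatched {U} S {u} {v} u∈A v∈B u∉B v∉A pf p≡q u≢p pg p≢q′ v≢p v≢q =
    split (same flexB p∈B q∈B (λ pq → pf p∈A q∈A pq p≡q))
    where
    open Glue S
    open SameAcross S u∈A v∈B u∉B v∉A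

    align-f : ∀ {g} → ProperIn B g → g p ≡ g q → g v ≢ g p → Joined U u v
    align-f pg′ p≡q′ v≢p′ =
      align pf pg′ (equal p≡q p≡q′) (differ u≢p v≢p′)
            (differ (≢-transʳ u≢p p≡q) (≢-transʳ v≢p′ p≡q′))

    split : Joined B p q → Joined U u v
    split (g₂ , pg₂ , p≡q₂) with g₂ v ≟ g₂ p
    ... | no  v≢p₂ = align-f pg₂ p≡q₂ v≢p₂
    ... | yes v≡p₂
      with twoTone flexB v∈B p∈B q∈B
             (independent (∉A⇒≢ v∉A p∈A) (λ vp → pg₂ v∈B p∈B vp v≡p₂))
             (independent (∉A⇒≢ v∉A q∈A) (λ vq → pg₂ v∈B q∈B vq (trans v≡p₂ p≡q₂)))
             (independent p≢q (λ pq → pf p∈A q∈A pq p≡q))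
    ...   | g₃ , pg₃ , lone₁ p≡q₃ v≢p₃ = align-f pg₃ p≡q₃ v≢p₃
    ...   | g₃ , pg₃ , lone₃ v≡p₃ q≢v₃ =
      join-via-p pg p≢q′ v≢p v≢q pg₂ p≡q₂ v≡p₂ pg₃ v≡p₃ q≢v₃
    ...   | g₃ , pg₃ , lone₂ v≡q₃ p≢v₃ =
      SameAcross.join-via-p (exchange S) u∈A v∈B u∉B v∉A
        pg (≢-sym p≢q′) v≢q v≢p pg₂ (sym p≡q₂) (trans v≡p₂ p≡q₂) pg₃ v≡q₃ p≢v₃

  -- Colourings that keep `u` and `v` off the colours of the cut fit together unless they disagree
  -- on whether `p` and `q` are equal.
  same-across : ∀ {U} (S : Gluing U) → let open Gluing S in
    ∀ {u v} → u ∈ A → v ∈ B → u ∉ B → v ∉ A → Joined U u v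
  same-across {U} S {u} {v} u∈A v∈B u∉B v∉A =
    combine (apart flexA u∈A p∈A q∈A (λ { refl → u∉B p∈B }) (λ { refl → u∉B q∈B }))
            (apart flexB v∈B p∈B q∈B (∉A⇒≢ v∉A p∈A) (∉A⇒≢ v∉A q∈A))
    where
    open Glue S
    open SameAcross S u∈A v∈B u∉B v∉A

    combine : Separated A u p q → Separated B v p q → Joined U u v
    combine (f , pf , u≢p , u≢q) (g , pg , v≢p , v≢q) with f p ≟ f q | g p ≟ g q
    ... | yes p≡q | yes p≡q′ = align pf pg (equal p≡q p≡q′) (differ u≢p v≢p) (differ u≢q v≢q)
    ... | no  p≢q | no  p≢q′ = align pf pg (differ p≢q p≢q′) (differ u≢p v≢p) (differ u≢q v≢q)
    ... | yes p≡q | no  p≢q′ = join-mismatched S u∈A v∈B u∉B v∉A pf p≡q u≢p pg p≢q′ v≢p v≢q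
    ... | no  p≢q | yes p≡q′ =
      let h , ph , eq =
            join-mismatched (mirror S) v∈B u∈A v∉A u∉B pg p≡q′ v≢p pf p≢q u≢p u≢q
      in h , ph , sym eq

  -- Separating one vertex from two others

  module Apart {U} (S : Gluing U) where
    open Glue S

    cut-apart : ∀ {v w} → v ∈ A → w ∈ B → p ≢ v → p ≢ w → Separated U p v w
    cut-apart v∈A w∈B p≢v p≢w =
      let f , pf , p≢v′ , p≢q₁ = apart flexA p∈A v∈A q∈A p≢v p≢q
          g , pg , p≢w′ , p≢q₂ = apart flexB p∈B w∈B q∈B p≢w p≢q
          h , ph , ext , _ , faithful =
            glue pf pg (differ p≢q₁ p≢q₂) p∈B (equal refl refl) (differ p≢q₁ p≢q₂)
      in h , ph , ≢-extends ext p∈A v∈A p≢v′ , faithful p∈B w∈B p≢w′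

    -- Besides `v`, the colouring `f₁` separates `u` from `p`, and `f₂` separates it from `q`. If
    -- either separates `u` from both cut vertices, `w` can avoid the colour of `u`. Otherwise `u`
    -- has the colour of `q` in `f₁` and that of `p` in `f₂`, and `w` need only differ from one cut
    -- vertex.
    across : ∀ {u v w} → u ∈ A → u ∉ B → v ∈ A → w ∈ B → u ≢ v → Separated U u v w
    across {u} {v} {w} u∈A u∉B v∈A w∈B u≢v
      with apart flexA u∈A v∈A p∈A u≢v (λ { refl → u∉B p∈B })
         | apart flexA u∈A v∈A q∈A u≢v (λ { refl → u∉B q∈B })
    ... | f₁ , pf₁ , u≢v₁ , u≢p₁ | f₂ , pf₂ , u≢v₂ , u≢q₂ with f₁ u ≟ f₁ q | f₂ u ≟ f₂ p
    ...   | no u≢q₁ | _ =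
      let g , pg , pq = match pf₁
          h , ph , ext , w≢u = extend-avoiding pf₁ pg pq w∈B u≢p₁ u≢q₁
      in h , ph , ≢-extends ext u∈A v∈A u≢v₁ , ≢-sym (≢-transʳ w≢u (sym (ext u∈A)))
    ...   | yes _ | no u≢p₂ =
      let g , pg , pq = match pf₂
          h , ph , ext , w≢u = extend-avoiding pf₂ pg pq w∈B u≢p₂ u≢q₂
      in h , ph , ≢-extends ext u∈A v∈A u≢v₂ , ≢-sym (≢-transʳ w≢u (sym (ext u∈A)))
    ...   | yes u≡q₁ | yes u≡p₂
      with apart flexB p∈B q∈B q∈B p≢q p≢q
    -- `g w` cannot equal both `g p` and `g q`, so one of `f₁` and `f₂` glues suitably with `g`.
    ...     | g , pg , p≢q′ , _ with g w ≟ g q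
    ...       | no w≢q =
      let f-pq = differ (λ p≡q → u≢p₁ (trans u≡q₁ (sym p≡q))) p≢q′
          h , ph , ext , _ , faithful = glue pf₁ pg f-pq p∈B (equal refl refl) f-pq
      in h , ph , ≢-extends ext u∈A v∈A u≢v₁ ,
         λ u≡w → faithful w∈B q∈B w≢q
           (trans (sym u≡w) (trans (ext u∈A) (trans u≡q₁ (sym (ext q∈A)))))
    ...       | yes w≡q =
      let f-pq = differ (λ p≡q → u≢q₂ (trans u≡p₂ p≡q)) p≢q′
          h , ph , ext , _ , faithful = glue pf₂ pg f-pq p∈B (equal refl refl) f-pq
      in h , ph , ≢-extends ext u∈A v∈A u≢v₂ ,
         λ u≡w → faithful w∈B p∈B (λ w≡p → p≢q′ (trans (sym w≡p) w≡q))
           (trans (sym u≡w) (trans (ext u∈A) (trans u≡p₂ (sym (ext p∈A)))))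

  module Lone {U} (S : Gluing U) {u v w} (u∈B : u ∈ Gluing.B S) (u∉A : u ∉ Gluing.A S)
    (v∈A : v ∈ Gluing.A S) (v∉B : v ∉ Gluing.B S)
    (w∈A : w ∈ Gluing.A S) (w∉B : w ∉ Gluing.B S) where
    open Glue S

    place : ∀ {f g c} → ProperIn A f → ProperIn B g →
            Alike (f p) (f q) (g p) (g q) →
            Alike c (f p) (g u) (g p) → Alike c (f q) (g u) (g q) →
            c ≢ f v → c ≢ f w → Separated U u v w
    place pf pg pq up uq c≢v c≢w =
      let h , ph , ext , hu , _ = glue pf pg pq u∈B up uq
      in h , ph , (λ eq → c≢v (trans (sym hu) (trans eq (ext v∈A))))
                , (λ eq → c≢w (trans (sym hu) (trans eq (ext w∈A))))

    -- With `p` and `q` sharing a colour, `u` must avoid only that colour and those of `v` and `w`;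
    -- four colours suffice.
    place-free : ∀ {g} → ProperIn B g → g p ≡ g q → g u ≢ g p →
                 Separated U u v w
    place-free {g} pg p≡q u≢p′ =
      let f , pf , p≡q′ = same flexA p∈A q∈A (λ pq → pg p∈B q∈B pq p≡q)
          c , new = fresh (lookup (f p ∷ f v ∷ f w ∷ [])) (s≤s 3≤k)
      in place pf pg (equal p≡q′ p≡q) (differ (new 0F) u≢p′)
           (differ (≢-transʳ (new 0F) p≡q′) (≢-transʳ u≢p′ p≡q)) (new 1F) (new 2F)

    -- Once `A` is coloured with `p` apart from `v` and `w`, the vertex `u` can take the colour of
    -- `p`: `g₁` serves if `q` has that colour as well, `g₂` if it does not.
    place-at-p : ∀ {g₁ g₂} →
      ProperIn B g₁ → g₁ p ≡ g₁ q → g₁ u ≡ g₁ p →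
      ProperIn B g₂ → g₂ u ≡ g₂ p → g₂ q ≢ g₂ u → Separated U u v w
    place-at-p pg₁ p≡q₁ u≡p₁ pg₂ u≡p₂ q≢u₂
      with apart flexA p∈A v∈A w∈A (λ { refl → v∉B p∈B }) (λ { refl → w∉B p∈B })
    ... | f , pf , p≢v′ , p≢w′ with f p ≟ f q
    ...   | yes p≡q  = place pf pg₁ (equal p≡q p≡q₁) (equal refl u≡p₁)
                         (equal p≡q (trans u≡p₁ p≡q₁)) p≢v′ p≢w′
    ...   | no  p≢q′ = place pf pg₂ (differ p≢q′ (≢-sym (≢-transʳ q≢u₂ u≡p₂))) (equal refl u≡p₂)
                         (differ p≢q′ (≢-sym q≢u₂)) p≢v′ p≢w′

  -- If `p` and `q` are nonadjacent, `B` is coloured with them equal, and two-toning `u`, `p`, `q`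
  -- resolves the case where `u` shares their colour.
  lone : ∀ {U} (S : Gluing U) → let open Gluing S in
    ∀ {u v w} → u ∈ B → u ∉ A → v ∈ A → v ∉ B → w ∈ A → w ∉ B → Separated U u v w
  lone {U} S {u} {v} {w} u∈B u∉A v∈A v∉B w∈A w∉B =
    start (apart flexB u∈B p∈B q∈B (∉A⇒≢ u∉A p∈A) (∉A⇒≢ u∉A q∈A))
    where
    open Glue S
    open Lone S u∈B u∉A v∈A v∉B w∈A w∉B

    merged : ¬ Adj G p q → Joined B p q → Separated U u v w
    merged ¬pq (g₁ , pg₁ , p≡q₁) with g₁ u ≟ g₁ p
    ... | no  u≢p₁ = place-free pg₁ p≡q₁ u≢p₁
    ... | yes u≡p₁
      with twoTone flexB u∈B p∈B q∈B
             (independent (∉A⇒≢ u∉A p∈A) (λ up → pg₁ u∈B p∈B up u≡p₁))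
             (independent (∉A⇒≢ u∉A q∈A) (λ uq → pg₁ u∈B q∈B uq (trans u≡p₁ p≡q₁)))
             (independent p≢q ¬pq)
    ...   | g₂ , pg₂ , lone₁ p≡q₂ u≢p₂ = place-free pg₂ p≡q₂ u≢p₂
    ...   | g₂ , pg₂ , lone₃ u≡p₂ q≢u₂ = place-at-p pg₁ p≡q₁ u≡p₁ pg₂ u≡p₂ q≢u₂
    ...   | g₂ , pg₂ , lone₂ u≡q₂ p≢u₂ =
      Lone.place-at-p (exchange S) u∈B u∉A v∈A v∉B w∈A w∉B
        pg₁ (sym p≡q₁) (trans u≡p₁ p≡q₁) pg₂ u≡q₂ p≢u₂

    start : Separated B u p q → Separated U u v w
    start (g , pg , u≢p , u≢q) with g p ≟ g q | adj? G p q
    ... | yes p≡q | _      = place-free pg p≡q u≢p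
    ... | no  _   | no ¬pq = merged ¬pq (same flexB p∈B q∈B ¬pq)
    -- Adjacent cut vertices differ in every proper colouring, so `u` needs a colour missing from
    -- four vertices of `A`: this is the purpose of `spare`.
    ... | no p≢q′ | yes pq =
      let f , pf , c , new = spare flexA (lookup (p ∷ q ∷ v ∷ w ∷ []))
            (λ { 0F → p∈A ; 1F → q∈A ; 2F → v∈A ; 3F → w∈A })
      in place pf pg (differ (pf p∈A q∈A pq) p≢q′) (differ (new 0F) u≢p) (differ (new 1F) u≢q)
               (new 2F) (new 3F)

  swap-targets : ∀ {U u v w} → Separated U u v w → Separated U u w v
  swap-targets (h , ph , u≢v , u≢w) = h , ph , u≢w , u≢v

  apart-from-A : ∀ {U} (S : Gluing U) → let open Gluing S in
    ∀ {u v w} → u ∈ A → v ∈ U → w ∈ U → u ≢ v → u ≢ w → Separated U u v w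
  apart-from-A {U} S {u} {v} {w} u∈A v∈U w∈U u≢v u≢w = go (cover v∈U) (cover w∈U)
    where
    open Glue S

    insideA : v ∈ A → w ∈ A → Separated U u v w
    insideA v∈A w∈A =
      let f , pf , u≢v′ , u≢w′ = apart flexA u∈A v∈A w∈A u≢v u≢w
          h , ph , ext = extendA pf
      in h , ph , ≢-extends ext u∈A v∈A u≢v′ , ≢-extends ext u∈A w∈A u≢w′

    insideB : u ∈ B → v ∈ B → w ∈ B → Separated U u v w
    insideB u∈B v∈B w∈B =
      let g , pg , u≢v′ , u≢w′ = apart flexB u∈B v∈B w∈B u≢v u≢w
          h , ph , ext = extendB pg
      in h , ph , ≢-extendsB ext u∈B v∈B u≢v′ , ≢-extendsB ext u∈B w∈B u≢w′
      where open Glue (mirror S) using () renaming (extendA to extendB; ≢-extends to ≢-extendsB)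

    mixed : ∀ {v w} → v ∈ A → w ∈ B → u ≢ v → u ≢ w → Separated U u v w
    mixed v∈A w∈B u≢v u≢w with u ∈? B
    ... | no  u∉B = Apart.across S u∈A u∉B v∈A w∈B u≢v
    ... | yes u∈B with common u∈A u∈B
    ...   | inj₁ refl = Apart.cut-apart S v∈A w∈B u≢v u≢w
    ...   | inj₂ refl = Apart.cut-apart (exchange S) v∈A w∈B u≢v u≢w

    outsideA : v ∈ B → w ∈ B → Separated U u v w
    outsideA v∈B w∈B with u ∈? B | v ∈? A | w ∈? A
    ... | yes u∈B | _       | _       = insideB u∈B v∈B w∈B
    ... | no _    | yes v∈A | _       = mixed v∈A w∈B u≢v u≢w
    ... | no _    | no _    | yes w∈A = swap-targets (mixed w∈A v∈B u≢w u≢v)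
    ... | no u∉B  | no v∉A  | no w∉A  = lone (mirror S) u∈A u∉B v∈B v∉A w∈B w∉A

    go : v ∈ A ⊎ v ∈ B → w ∈ A ⊎ w ∈ B → Separated U u v w
    go (inj₁ v∈A) (inj₁ w∈A) = insideA v∈A w∈A
    go (inj₁ v∈A) (inj₂ w∈B) = mixed v∈A w∈B u≢v u≢w
    go (inj₂ v∈B) (inj₁ w∈A) = swap-targets (mixed w∈A v∈B u≢w u≢v)
    go (inj₂ v∈B) (inj₂ w∈B) = outsideA v∈B w∈B

  -- Two-toned triples across the cut

  rotate′ : ∀ {U u v w} → TwoToned U u v w → TwoToned U v w u
  rotate′ (h , ph , t) = h , ph , rotate t

  reflect′ : ∀ {U u v w} → TwoToned U u v w → TwoToned U u w v
  reflect′ (h , ph , t) = h , ph , reflect t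

  module TwoToneAcross {U} (S : Gluing U) {d} (d∈B : d ∈ Gluing.B S) (d∉A : d ∉ Gluing.A S)
    {v w} (v∈A : v ∈ Gluing.A S) (w∈A : w ∈ Gluing.A S) where
    open Glue S

    place : ∀ {f g c} → ProperIn A f → ProperIn B g →
            Alike (f p) (f q) (g p) (g q) →
            Alike c (f p) (g d) (g p) → Alike c (f q) (g d) (g q) →
            TwoTone c (f v) (f w) → TwoToned U d v w
    place pf pg pq dp dq t =
      let h , ph , ext , hd , _ = glue pf pg pq d∈B dp dq
      in h , ph , TwoTone-resp (sym hd) (sym (ext v∈A)) (sym (ext w∈A)) t

    -- The colour of `v` and `w` is represented in `B` by `p`, so keeping `d` apart from `p` makes
    -- `d` the lone vertex.
    detached : ∀ {f g} → ProperIn A f → f v ≡ f w → f v ≡ f p →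
               ProperIn B g → Alike (f p) (f q) (g p) (g q) → g d ≢ g p → TwoToned U d v w
    detached pf v≡w v≡p pg pq d≢p =
      let h , ph , ext , _ , faithful = glue pf pg pq p∈B (equal refl refl) pq
      in h , ph , lone₁ (trans (ext v∈A) (trans v≡w (sym (ext w∈A))))
                        (≢-transʳ (faithful d∈B p∈B d≢p)
                                  (trans (ext p∈A) (trans (sym v≡p) (sym (ext v∈A)))))

    paired-at-p : ∀ {f} → ProperIn A f → f v ≡ f w → f v ≡ f p →
                  f p ≢ f q → TwoToned U d v w
    paired-at-p pf v≡w v≡p p≢q′ =
      let g , pg , p≢q″ , p≢d = apart flexB p∈B q∈B d∈B p≢q (≢-sym (∉A⇒≢ d∉A p∈A))
      in detached pf v≡w v≡p pg (differ p≢q′ p≢q″) (≢-sym p≢d)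

    -- f₀ and g do not combine, as only f₀ identifies p with q.  A colouring of A that
    -- distinguishes v from w is extended instead, with d joining one of them.
    module Rainbow {f₀ g : Fin n → Fin (suc k)}
      (pf₀ : ProperIn A f₀) (v≡w₀ : f₀ v ≡ f₀ w) (v≡p₀ : f₀ v ≡ f₀ p) (p≡q₀ : f₀ p ≡ f₀ q)
      (pg : ProperIn B g) (d≢p : g d ≢ g p) (d≢q : g d ≢ g q) (p≢q′ : g p ≢ g q) where

      -- If `f` identifies `p` and `q`, then `g₁` lets `d` join `v` or `w`. If not, and `w` avoids
      -- the colour of `q`, then `g` lets `d` join `w`. In the remaining case `v` and `w` carry the
      -- colours of `p` and `q`: either a colouring of `B` fits `f₀` with `d` detached, or `d`, `p`,
      -- `q` are independent and two-toning them pairs `d` with one cut vertex.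
      resolve : ∀ {f} → ProperIn A f → f v ≡ f p → f w ≢ f v →
                TwoToned U d v w
      resolve {f} pf v≡p w≢v with f p ≟ f q
                                | same flexB p∈B q∈B (λ pq → pf₀ p∈A q∈A pq p≡q₀)
      ... | yes p≡q | g₁ , pg₁ , p≡q₁ with g₁ d ≟ g₁ p
      ...   | yes d≡p₁ = place pf pg₁ (equal p≡q p≡q₁) (equal refl d≡p₁)
                               (equal p≡q (trans d≡p₁ p≡q₁)) (lone₃ (sym v≡p) (≢-transʳ w≢v v≡p))
      ...   | no  d≢p₁ = place pf pg₁ (equal p≡q p≡q₁) (differ (≢-transʳ w≢v v≡p) d≢p₁)
                               (differ (≢-transʳ w≢v (trans v≡p p≡q)) (≢-transʳ d≢p₁ p≡q₁))
                               (lone₂ refl (≢-sym w≢v))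
      resolve {f} pf v≡p w≢v | no p≢q₁ | g₁ , pg₁ , p≡q₁ with f w ≟ f q | g₁ d ≟ g₁ p
      ...   | no w≢q  | _ = place pf pg (differ p≢q₁ p≢q′) (differ (≢-transʳ w≢v v≡p) d≢p)
                                  (differ w≢q d≢q) (lone₂ refl (≢-sym w≢v))
      ...   | yes _   | no d≢p₁ = detached pf₀ v≡w₀ v≡p₀ pg₁ (equal p≡q₀ p≡q₁) d≢p₁
      ...   | yes w≡q | yes d≡p₁
        with twoTone flexB d∈B p∈B q∈B
               (independent (∉A⇒≢ d∉A p∈A) (λ dp → pg₁ d∈B p∈B dp d≡p₁))
               (independent (∉A⇒≢ d∉A q∈A) (λ dq → pg₁ d∈B q∈B dq (trans d≡p₁ p≡q₁)))
               (independent p≢q (λ pq → pf₀ p∈A q∈A pq p≡q₀))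
      ...     | g₂ , pg₂ , lone₁ p≡q₂ d≢p₂ = detached pf₀ v≡w₀ v≡p₀ pg₂ (equal p≡q₀ p≡q₂) d≢p₂
      ...     | g₂ , pg₂ , lone₃ d≡p₂ q≢d₂ =
        place pf pg₂ (differ p≢q₁ (≢-sym (≢-transʳ q≢d₂ d≡p₂))) (equal refl d≡p₂)
              (differ p≢q₁ (≢-sym q≢d₂)) (lone₃ (sym v≡p) (≢-transʳ w≢v v≡p))
      ...     | g₂ , pg₂ , lone₂ d≡q₂ p≢d₂ =
        place pf pg₂ (differ p≢q₁ (≢-transʳ p≢d₂ d≡q₂)) (differ (≢-sym p≢q₁) (≢-sym p≢d₂))
              (equal refl d≡q₂) (lone₂ (sym w≡q) (λ v≡q → w≢v (trans w≡q (sym v≡q))))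

      resolve-equal : v ≡ p → v ≢ w → TwoToned U d v w
      resolve-equal refl v≢w =
        let f , pf , w≢v , _ = apart flexA w∈A v∈A v∈A (≢-sym v≢w) (≢-sym v≢w)
        in resolve pf refl w≢v

  -- Starting with `v` and `w` of one colour, `d` can get a different colour except possibly when
  -- that colour is also that of both `p` and `q`. Only then is `Rainbow` needed.
  twoTone-across : ∀ {U} (S : Gluing U) → let open Gluing S in
    ∀ {d v w} → d ∈ B → d ∉ A → v ∈ A → w ∈ A → Independent v w → TwoToned U d v w
  twoTone-across {U} S {d} {v} {w} d∈B d∉A v∈A w∈A (independent v≢w ¬vw) =
    start (same flexA v∈A w∈A ¬vw)
    where
    open Glue S
    open TwoToneAcross S d∈B d∉A v∈A w∈A

    paired : ∀ {f} → ProperIn A f → f v ≡ f w →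
             TwoToned U d v w ⊎ (f v ≡ f p × f p ≡ f q)
    paired {f} pf v≡w with f v ≟ f p | f v ≟ f q
    ... | yes v≡p | yes v≡q = inj₂ (v≡p , trans (sym v≡p) v≡q)
    ... | yes v≡p | no  v≢q = inj₁ (paired-at-p pf v≡w v≡p (λ p≡q → v≢q (trans v≡p p≡q)))
    ... | no  v≢p | yes v≡q = inj₁
      (TwoToneAcross.paired-at-p (exchange S) d∈B d∉A v∈A w∈A pf v≡w v≡q
        (λ q≡p → v≢p (trans v≡q q≡p)))
    ... | no  v≢p | no  v≢q =
      let g , pg , pq = match pf
          h , ph , ext , d≢v = extend-avoiding pf pg pq d∈B v≢p v≢q
      in inj₁ (h , ph , lone₁ (trans (ext v∈A) (trans v≡w (sym (ext w∈A))))
                              (≢-transʳ d≢v (sym (ext v∈A))))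

    module _ {f₀ g : Fin n → Fin (suc k)}
      (pf₀ : ProperIn A f₀) (v≡w₀ : f₀ v ≡ f₀ w) (v≡p₀ : f₀ v ≡ f₀ p) (p≡q₀ : f₀ p ≡ f₀ q)
      (pg : ProperIn B g) (d≢p : g d ≢ g p) (d≢q : g d ≢ g q) (p≢q′ : g p ≢ g q) where

      w≡p₀ = trans (sym v≡w₀) v≡p₀
      module V  = Rainbow pf₀ v≡w₀ v≡p₀ p≡q₀ pg d≢p d≢q p≢q′
      module W  = TwoToneAcross.Rainbow S d∈B d∉A w∈A v∈A
                    pf₀ (sym v≡w₀) w≡p₀ p≡q₀ pg d≢p d≢q p≢q′
      module V′ = TwoToneAcross.Rainbow (exchange S) d∈B d∉A v∈A w∈A
                    pf₀ v≡w₀ (trans v≡p₀ p≡q₀) (sym p≡q₀) pg d≢q d≢p (≢-sym p≢q′)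

      rainbow : TwoToned U d v w
      rainbow with v ≟ p | v ≟ q | w ≟ p
      ... | yes v≡p | _       | _       = V.resolve-equal v≡p v≢w
      ... | no  _   | yes v≡q | _       = V′.resolve-equal v≡q v≢w
      ... | no  _   | no  _   | yes w≡p = reflect′ (W.resolve-equal w≡p (≢-sym v≢w))
      ... | no  v≢p | no  v≢q | no  w≢p
        -- `f₀` gives `v`, `w`, `p` one colour, so being distinct they are independent.
        with twoTone flexA v∈A w∈A p∈A (independent v≢w ¬vw)
               (independent v≢p (λ vp → pf₀ v∈A p∈A vp v≡p₀))
               (independent w≢p (λ wp → pf₀ w∈A p∈A wp w≡p₀))
      ...   | f , pf , lone₁ w≡p v≢w′ = reflect′ (W.resolve pf w≡p v≢w′)
      ...   | f , pf , lone₂ v≡p w≢v  = V.resolve pf v≡p w≢v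
      ...   | f , pf , lone₃ v≡w p≢v with paired pf v≡w
      ...     | inj₁ done      = done
      -- The exceptional case of `paired` would give `v` the colour of `p`, but here `p` is the lone
      -- vertex.
      ...     | inj₂ (v≡p , _) = contradiction (sym v≡p) p≢v

    start : Joined A v w → TwoToned U d v w
    start (f₀ , pf₀ , v≡w₀) with paired pf₀ v≡w₀
                               | apart flexB d∈B p∈B q∈B (∉A⇒≢ d∉A p∈A) (∉A⇒≢ d∉A q∈A)
    ... | inj₁ done | _ = done
    ... | inj₂ (v≡p₀ , p≡q₀) | g , pg , d≢p , d≢q with g p ≟ g q
    ...   | yes p≡q = detached pf₀ v≡w₀ v≡p₀ pg (equal p≡q₀ p≡q) d≢p
    ...   | no  p≢q′ = rainbow pf₀ v≡w₀ v≡p₀ p≡q₀ pg d≢p d≢q p≢q′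

  module FromA {U} (S : Gluing U) where
    open Glue S

    same-AA : ∀ {x y} → x ∈ A → y ∈ A → ¬ Adj G x y → Joined U x y
    same-AA x∈A y∈A ¬xy =
      let f , pf , eq = same flexA x∈A y∈A ¬xy
          h , ph , ext = extendA pf
      in h , ph , trans (ext x∈A) (trans eq (sym (ext y∈A)))

    twoTone-AAA : ∀ {x y z} → x ∈ A → y ∈ A → z ∈ A →
      Independent x y → Independent x z → Independent y z → TwoToned U x y z
    twoTone-AAA x∈A y∈A z∈A xy xz yz =
      let f , pf , t = twoTone flexA x∈A y∈A z∈A xy xz yz
          h , ph , ext = extendA pf
      in h , ph , TwoTone-resp (sym (ext x∈A)) (sym (ext y∈A)) (sym (ext z∈A)) t

    twoTone-BAA : ∀ {x y z} → x ∈ B → y ∈ A → z ∈ A →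
      Independent x y → Independent x z → Independent y z → TwoToned U x y z
    twoTone-BAA {x} x∈B y∈A z∈A xy xz yz with x ∈? A
    ... | yes x∈A = twoTone-AAA x∈A y∈A z∈A xy xz yz
    ... | no  x∉A = twoTone-across S x∈B x∉A y∈A z∈A yz

    twoTone-AAB : ∀ {x y z} → x ∈ A → y ∈ A → z ∈ B →
      Independent x y → Independent x z → Independent y z → TwoToned U x y z
    twoTone-AAB x∈A y∈A z∈B xy xz yz =
      rotate′ (twoTone-BAA z∈B x∈A y∈A (independent-sym xz) (independent-sym yz) xy)

    twoTone-ABA : ∀ {x y z} → x ∈ A → y ∈ B → z ∈ A →
      Independent x y → Independent x z → Independent y z → TwoToned U x y z
    twoTone-ABA x∈A y∈B z∈A xy xz yz =
      reflect′ (twoTone-AAB x∈A z∈A y∈B xz xy (independent-sym yz))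

  -- Two of any three vertices lie on a common side, so `FromA` for the gluing and for its mirror
  -- image covers all two-toned cases.
  flexible-glued : ∀ {U} → Gluing U → Flexible U
  flexible-glued {U} S = record { same = same′ ; apart = apart′ ; twoTone = twoTone′ }
    where
    open Gluing S using (A; B; cover)
    open FromA S
    open FromA (mirror S) using () renaming
      ( same-AA to same-BB ; twoTone-AAA to twoTone-BBB ; twoTone-BAA to twoTone-ABB
      ; twoTone-AAB to twoTone-BBA ; twoTone-ABA to twoTone-BAB )

    same-AB : ∀ {x y} → x ∈ A → y ∈ B → ¬ Adj G x y → Joined U x y
    same-AB {x} {y} x∈A y∈B ¬xy with x ∈? B | y ∈? A
    ... | yes x∈B | _       = same-BB x∈B y∈B ¬xy
    ... | no  _   | yes y∈A = same-AA x∈A y∈A ¬xy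
    ... | no  x∉B | no  y∉A = same-across S x∈A y∈B x∉B y∉A

    same′ : ∀ {x y} → x ∈ U → y ∈ U → ¬ Adj G x y → Joined U x y
    same′ x∈U y∈U ¬xy with cover x∈U | cover y∈U
    ... | inj₁ x∈A | inj₁ y∈A = same-AA x∈A y∈A ¬xy
    ... | inj₂ x∈B | inj₂ y∈B = same-BB x∈B y∈B ¬xy
    ... | inj₁ x∈A | inj₂ y∈B = same-AB x∈A y∈B ¬xy
    ... | inj₂ x∈B | inj₁ y∈A =
      let h , ph , eq = same-AB y∈A x∈B (¬xy ∘ symm G) in h , ph , sym eq

    apart′ : ∀ {x y z} → x ∈ U → y ∈ U → z ∈ U → x ≢ y → x ≢ z → Separated U x y z
    apart′ x∈U y∈U z∈U x≢y x≢z with cover x∈U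
    ... | inj₁ x∈A = apart-from-A S x∈A y∈U z∈U x≢y x≢z
    ... | inj₂ x∈B = apart-from-A (mirror S) x∈B y∈U z∈U x≢y x≢z

    twoTone′ : ∀ {x y z} → x ∈ U → y ∈ U → z ∈ U →
               Independent x y → Independent x z → Independent y z → TwoToned U x y z
    twoTone′ x∈U y∈U z∈U with cover x∈U | cover y∈U | cover z∈U
    ... | inj₁ x∈A | inj₁ y∈A | inj₁ z∈A = twoTone-AAA x∈A y∈A z∈A
    ... | inj₁ x∈A | inj₁ y∈A | inj₂ z∈B = twoTone-AAB x∈A y∈A z∈B
    ... | inj₁ x∈A | inj₂ y∈B | inj₁ z∈A = twoTone-ABA x∈A y∈B z∈A
    ... | inj₁ x∈A | inj₂ y∈B | inj₂ z∈B = twoTone-ABB x∈A y∈B z∈B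
    ... | inj₂ x∈B | inj₁ y∈A | inj₁ z∈A = twoTone-BAA x∈B y∈A z∈A
    ... | inj₂ x∈B | inj₁ y∈A | inj₂ z∈B = twoTone-BAB x∈B y∈A z∈B
    ... | inj₂ x∈B | inj₂ y∈B | inj₁ z∈A = twoTone-BBA x∈B y∈B z∈A
    ... | inj₂ x∈B | inj₂ y∈B | inj₂ z∈B = twoTone-BBB x∈B y∈B z∈B

-- Connectivity and cutsets

∈─⇒∉ : (p q : Subset n) {x : Fin n} → x ∈ p ─ q → x ∉ q
∈─⇒∉ (_ ∷ p) (outside ∷ q) (there x∈) (there x∈q) = ∈─⇒∉ p q x∈ x∈q
∈─⇒∉ (_ ∷ p) (inside ∷ q) (there x∈) (there x∈q) = ∈─⇒∉ p q x∈ x∈q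

image : (Fin j → Fin n) → Subset n
image {zero}  t = ⊥
image {suc j} t = ⁅ t zero ⁆ ∪ image (t ∘ suc)

∈-image : (t : Fin j → Fin n) (i : Fin j) → t i ∈ image t
∈-image t zero    = x∈p∪q⁺ (inj₁ (x∈⁅x⁆ (t zero)))
∈-image t (suc i) = x∈p∪q⁺ (inj₂ (∈-image (t ∘ suc) i))

image-∈ : (t : Fin j → Fin n) {x : Fin n} → x ∈ image t → ∃[ i ] x ≡ t i
image-∈ {zero}  t x∈ = contradiction x∈ ∉⊥
image-∈ {suc j} t x∈ with x∈p∪q⁻ ⁅ t zero ⁆ (image (t ∘ suc)) x∈
... | inj₁ x∈₀ = zero , x∈⁅y⁆⇒x≡y (t zero) x∈₀
... | inj₂ x∈₊ with i , eq ← image-∈ (t ∘ suc) x∈₊ = suc i , eq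

-- A positive certificate of disconnectedness: a negated `Connected` does not by itself provide the
-- two sides needed for a gluing.
record Split (H : Graph n) : Set where
  field
    S      : Subset n
    a b    : Fin n
    a∈V    : a ∈ V H
    b∈V    : b ∈ V H
    a∈S    : a ∈ S
    b∉S    : b ∉ S
    closed : ∀ {x y} → Adj H x y → x ∈ S → y ∈ S

split⇒disconnected : {H : Graph n} → Split H → ¬ Connected H
split⇒disconnected {H = H} sp conn = b∉S (follow (conn a∈V b∈V) a∈S)
  where
  open Split sp
  follow : ∀ {x y} → Star (Adj H) x y → x ∈ S → y ∈ S
  follow ε        x∈S = x∈S
  follow (e ◅ es) x∈S = follow es (closed e x∈S)

-- The set grows by an endpoint of a leaving edge until no edge leaves it; strict growth within a
-- finite set terminates.
component : (H : Graph n) (x : Fin n) → ∃[ R ] x ∈ R ×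
            (∀ {y z} → Adj H y z → y ∈ R → z ∈ R) × (∀ {y} → y ∈ R → Star (Adj H) x y)
component H x = grow ⁅ x ⁆ (⊃-wellFounded _) (x∈⁅x⁆ x)
                  λ y∈ → subst (Star (Adj H) x) (sym (x∈⁅y⁆⇒x≡y x y∈)) ε
  where
  grow : ∀ R → Acc (flip _⊂_) R → x ∈ R → (∀ {y} → y ∈ R → Star (Adj H) x y) →
         ∃[ R ] x ∈ R × (∀ {y z} → Adj H y z → y ∈ R → z ∈ R) × (∀ {y} → y ∈ R → Star (Adj H) x y)
  grow R (acc rs) x∈R reach
    with any? (λ y → any? λ z → adj? H y z ×-dec ((y ∈? R) ×-dec ¬? (z ∈? R)))
  ... | no  none = R , x∈R ,
    (λ {y} {z} yz y∈R → decidable-stable (z ∈? R) λ z∉R → none (y , z , yz , y∈R , z∉R)) , reach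
  ... | yes (y , z , yz , y∈R , z∉R) =
    grow (R ∪ ⁅ z ⁆) (rs (p⊆p∪q ⁅ z ⁆ , z , x∈p∪q⁺ (inj₂ (x∈⁅x⁆ z)) , z∉R))
         (p⊆p∪q ⁅ z ⁆ x∈R) λ w∈ → [ reach , at-z ]′ (x∈p∪q⁻ R ⁅ z ⁆ w∈)
    where
    at-z : ∀ {w} → w ∈ ⁅ z ⁆ → Star (Adj H) x w
    at-z w∈ = subst (Star (Adj H) x) (sym (x∈⁅y⁆⇒x≡y z w∈)) (reach y∈R ◅◅ yz ◅ ε)

connected-or-split : (H : Graph n) → Connected H ⊎ Split H
connected-or-split H
  with any? (λ x → any? λ y → (x ∈? V H) ×-dec ((y ∈? V H) ×-dec ¬? (y ∈? proj₁ (component H x))))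
... | yes (x , y , x∈V , y∈V , y∉R) =
  let R , x∈R , closed , _ = component H x
  in inj₂ record
    { S = R ; a = x ; b = y ; a∈V = x∈V ; b∈V = y∈V ; a∈S = x∈R ; b∉S = y∉R ; closed = closed }
... | no none = inj₁ λ {x} {y} x∈V y∈V →
  let R , _ , _ , reach = component H x
  in reach (decidable-stable (y ∈? R) λ y∉R → none (x , y , x∈V , y∈V , y∉R))

connected? : (H : Graph n) → Dec (Connected H)
connected? H with connected-or-split H
... | inj₁ conn = yes conn
... | inj₂ sp   = no (split⇒disconnected sp)

smallCutset? : (H : Graph n) (k : ℕ) → Dec (∃[ X ] Cutset H X × ∣ X ∣ < k)
smallCutset? H k = anySubset? λ X → ((X ⊆? V H) ×-dec ¬? (connected? (H ∖ X))) ×-dec (∣ X ∣ <? k)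

_-connected?_ : (k : ℕ) (H : Graph n) → Dec (k -Connected H)
k -connected? H = (k <? ∣ V H ∣) ×-dec ¬? (smallCutset? H k)

induced : Graph n → Subset n → Graph n
induced G U = record
  { V      = U
  ; Adj    = λ x y → x ∈ U × y ∈ U × Adj G x y
  ; adj?   = λ x y → (x ∈? U) ×-dec ((y ∈? U) ×-dec adj? G x y)
  ; adj-∈  = proj₁
  ; symm   = λ (x∈ , y∈ , xy) → y∈ , x∈ , symm G xy
  ; irrefl = λ eq (_ , _ , xy) → irrefl G eq xy
  }

induced-⊑ : (G : Graph n) {U : Subset n} → U ⊆ V G → induced G U ⊑ G
induced-⊑ G U⊆V = U⊆V , λ (_ , _ , xy) → xy

colourable-mono : (H : Graph n) → m ≤ j → m -Colourable H → j -Colourable H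
colourable-mono H m≤j (c , pc) =
  (λ v → inject≤ (c v) m≤j) , λ u v uv → pc u v uv ∘ inject≤-injective _ _ _ _

small-colourable : (H : Graph n) → ∣ V H ∣ ≤ m → m -Colourable H
small-colourable H small = colourable-mono H small
  ((λ (x , x∈V) → proj₁ (enum-onto (V H) x∈V)) , λ (x , x∈V) (y , y∈V) xy eq →
    irrefl H (trans (sym (proj₂ (enum-onto (V H) x∈V)))
                    (trans (cong (enum (V H)) eq) (proj₂ (enum-onto (V H) y∈V)))) xy)

¬colourable⇒<χ : (H : Graph n) → ¬ m -Colourable H → m < χ H
¬colourable⇒<χ H ¬c = ≰⇒> λ χ≤m → ¬c (colourable-mono H χ≤m (proj₁ (proj₂ (chromaticNumber H))))

colourable⇒χ≤ : (H : Graph n) → m -Colourable H → χ H ≤ m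
colourable⇒χ≤ H = proj₂ (proj₂ (chromaticNumber H)) _

within⇒colourable : (G : Graph n) {f : Fin n → Fin m} → ProperWithin G (V G) f → m -Colourable G
within⇒colourable G {f} pf = f ∘ proj₁ , λ (_ , x∈) (_ , y∈) → pf x∈ y∈

-- There must be at least one colour, since `extend` uses colour zero outside `U`.
colourable⇒within : (G : Graph n) {U : Subset n} → suc m -Colourable (induced G U) →
                    ∃[ f ] ProperWithin {m = suc m} G U f
colourable⇒within G {U} (c , pc) = extend (induced G U) c , λ x∈ y∈ xy eq →
  pc (_ , x∈) (_ , y∈) (x∈ , y∈ , xy)
    (trans (sym (extend-∈ (induced G U) c (_ , x∈))) (trans eq (extend-∈ (induced G U) c (_ , y∈))))

clique-3-connected : (G : Graph n) (t : Fin 4 → Fin n) → (∀ i l → i ≢ l → Adj G (t i) (t l)) →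
                     3 -Connected (induced G (image t))
clique-3-connected G t edge =
  injection⇒≤∣∣ (image t) t inj (∈-image t) , λ (X , (_ , ¬conn) , _) → ¬conn (conn X)
  where
  inj : ∀ {i l} → t i ≡ t l → i ≡ l
  inj {i} {l} eq = decidable-stable (i ≟ l) λ i≢l → irrefl G eq (edge i l i≢l)

  conn : ∀ X → Connected (induced G (image t) ∖ X)
  conn X {x} {y} x∈ y∈ with x ≟ y
  ... | yes refl = ε
  ... | no  x≢y
    with x∈t ← p─q⊆p (image t) X x∈ | y∈t ← p─q⊆p (image t) X y∈
    with image-∈ t x∈t | image-∈ t y∈t
  ...   | i , refl | l , refl =
    ((x∈t , y∈t , edge i l (x≢y ∘ cong t)) , ∈─⇒∉ (image t) X x∈ , ∈─⇒∉ (image t) X y∈) ◅ ε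

-- Keeping `a` and `b` off the cut ensures that each side of the later gluing misses a vertex of
-- `U`, so the induction descends.
record CutPair (X U : Subset n) (a b : Fin n) : Set where
  field
    p q  : Fin n
    p∈U  : p ∈ U
    q∈U  : q ∈ U
    p≢q  : p ≢ q
    a≢p  : a ≢ p
    a≢q  : a ≢ q
    b≢p  : b ≢ p
    b≢q  : b ≢ q
    X⊆pq : ∀ {x} → x ∈ X → x ≡ p ⊎ x ≡ q

-- A cutset with fewer than two vertices is padded with arbitrary vertices of U.
cutPair : (X U : Subset n) {a b : Fin n} → X ⊆ U → ∣ X ∣ < 3 → 3 < ∣ U ∣ → a ∉ X → b ∉ X →
          CutPair X U a b
cutPair {n} X U {a} {b} X⊆U ∣X∣<3 3<∣U∣ a∉X b∉X =
  pair (choose (lookup (a ∷ b ∷ [])) (ℕ.<-trans ℕ.≤-refl 3<∣U∣))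
  where
  -- Elements of `X` are preferred: the last component says that the choice falls outside `X` only
  -- when `X` has nothing left outside the range of `t`.
  choose : (t : Fin j → Fin n) → j < ∣ U ∣ → ∃[ x ] x ∈ U × (∀ i → x ≢ t i) ×
           (∀ {y} → y ∈ X → (∀ i → y ≢ t i) → x ∈ X)
  choose t j<∣U∣ with any? (λ x → (x ∈? X) ×-dec all? λ i → ¬? (x ≟ t i))
  ... | yes (x , x∈X , new) = x , X⊆U x∈X , new , λ _ _ → x∈X
  ... | no  none with x , x∈U , new ← avoiding U t j<∣U∣ =
    x , x∈U , new , λ {y} y∈X y-new → contradiction (y , y∈X , y-new) none

  pair : ∃[ x ] x ∈ U × (∀ i → x ≢ lookup (a ∷ b ∷ []) i) ×
         (∀ {y} → y ∈ X → (∀ i → y ≢ lookup (a ∷ b ∷ []) i) → x ∈ X) → CutPair X U a b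
  pair (p , p∈U , p-new , p∈X) with choose (lookup (a ∷ b ∷ p ∷ [])) 3<∣U∣
  ... | q , q∈U , q-new , q∈X = record
    { p = p ; q = q ; p∈U = p∈U ; q∈U = q∈U ; p≢q = ≢-sym (q-new 2F)
    ; a≢p = ≢-sym (p-new 0F) ; a≢q = ≢-sym (q-new 0F)
    ; b≢p = ≢-sym (p-new 1F) ; b≢q = ≢-sym (q-new 1F) ; X⊆pq = X⊆pq }
    where
    X⊆pq : ∀ {x} → x ∈ X → x ≡ p ⊎ x ≡ q
    X⊆pq {x} x∈X with x ≟ p | x ≟ q
    ... | yes x≡p | _       = inj₁ x≡p
    ... | no  _   | yes x≡q = inj₂ x≡q
    -- A further element of `X` would have been available at both choices, so `p`, `q` and `x` would
    -- be three elements of `X`.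
    ... | no  x≢p | no  x≢q = contradiction ∣X∣<3 (ℕ.≤⇒≯ (injection⇒≤∣∣ X t inj t∈X))
      where
      t = lookup (p ∷ q ∷ x ∷ [])
      x≢a : x ≢ a
      x≢a refl = a∉X x∈X
      x≢b : x ≢ b
      x≢b refl = b∉X x∈X
      t∈X : ∀ i → t i ∈ X
      t∈X 0F = p∈X x∈X λ { 0F → x≢a ; 1F → x≢b }
      t∈X 1F = q∈X x∈X λ { 0F → x≢a ; 1F → x≢b ; 2F → x≢p }
      t∈X 2F = x∈X
      inj : ∀ {i l} → t i ≡ t l → i ≡ l
      inj {0F} {0F} _ = refl
      inj {1F} {1F} _ = refl
      inj {2F} {2F} _ = refl
      inj {0F} {1F} eq = contradiction (sym eq) (q-new 2F)
      inj {1F} {0F} eq = contradiction eq (q-new 2F)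
      inj {0F} {2F} eq = contradiction (sym eq) x≢p
      inj {2F} {0F} eq = contradiction eq x≢p
      inj {1F} {2F} eq = contradiction (sym eq) x≢q
      inj {2F} {1F} eq = contradiction eq x≢q

module Side {n} (U : Subset n) (p q : Fin n) where

  side : Subset n → Subset n
  side T = U ∩ (T ∪ (⁅ p ⁆ ∪ ⁅ q ⁆))

  side⊆U : ∀ T → side T ⊆ U
  side⊆U T = p∩q⊆p U (T ∪ (⁅ p ⁆ ∪ ⁅ q ⁆))

  rest-∈ : ∀ T {x} → x ∈ U → x ∈ T → x ∈ side T
  rest-∈ T x∈U x∈T = x∈p∩q⁺ (x∈U , x∈p∪q⁺ (inj₁ x∈T))

  cut-∈ : ∀ T {x} → x ∈ U → x ≡ p ⊎ x ≡ q → x ∈ side T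
  cut-∈ T x∈U (inj₁ refl) = x∈p∩q⁺ (x∈U , x∈p∪q⁺ (inj₂ (x∈p∪q⁺ (inj₁ (x∈⁅x⁆ p)))))
  cut-∈ T x∈U (inj₂ refl) = x∈p∩q⁺ (x∈U , x∈p∪q⁺ (inj₂ (x∈p∪q⁺ (inj₂ (x∈⁅x⁆ q)))))

  side-∈ : ∀ T {x} → x ∈ side T → x ∈ T ⊎ (x ≡ p ⊎ x ≡ q)
  side-∈ T x∈ with x∈p∪q⁻ T (⁅ p ⁆ ∪ ⁅ q ⁆) (proj₂ (x∈p∩q⁻ U (T ∪ (⁅ p ⁆ ∪ ⁅ q ⁆)) x∈))
  ... | inj₁ x∈T  = inj₁ x∈T
  ... | inj₂ x∈pq = inj₂ (Sum.map (x∈⁅y⁆⇒x≡y p) (x∈⁅y⁆⇒x≡y q) (x∈p∪q⁻ ⁅ p ⁆ ⁅ q ⁆ x∈pq))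

-- The induction

-- Colour zero is new and reserved for `s` and `t`, all old colours being shifted by one. Taking `s`
-- equal to `t` reserves it for a single vertex.
mark : Fin n → Fin n → (Fin n → Fin m) → Fin n → Fin (suc m)
mark s t f x with (x ≟ s) ⊎-dec (x ≟ t)
... | yes _ = zero
... | no  _ = suc (f x)

module _ (s t : Fin n) (f : Fin n → Fin m) where

  mark-hit : ∀ {x} → x ≡ s ⊎ x ≡ t → mark s t f x ≡ zero
  mark-hit {x} hit with (x ≟ s) ⊎-dec (x ≟ t)
  ... | yes _   = refl
  ... | no  out = contradiction hit out

  mark-miss : ∀ {x} → x ≢ s → x ≢ t → mark s t f x ≢ zero
  mark-miss {x} x≢s x≢t eq with (x ≟ s) ⊎-dec (x ≟ t)
  ... | yes hit = [ x≢s , x≢t ]′ hit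
  ... | no  _   = contradiction (sym eq) 0≢1+n

  mark-proper : (G : Graph n) {U : Subset n} → ¬ Adj G s t → ProperWithin G U f →
                ProperWithin G U (mark s t f)
  mark-proper G ¬st pf {x} {y} x∈ y∈ xy eq with (x ≟ s) ⊎-dec (x ≟ t) | (y ≟ s) ⊎-dec (y ≟ t)
  ... | no  _ | no  _ = pf x∈ y∈ xy (suc-injective eq)
  ... | yes _ | no  _ = 0≢1+n eq
  ... | no  _ | yes _ = 0≢1+n (sym eq)
  ... | yes (inj₁ refl) | yes (inj₁ refl) = irrefl G refl xy
  ... | yes (inj₁ refl) | yes (inj₂ refl) = ¬st xy
  ... | yes (inj₂ refl) | yes (inj₁ refl) = ¬st (symm G xy)
  ... | yes (inj₂ refl) | yes (inj₂ refl) = irrefl G refl xy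

-- Here `m` is `suc (suc l)`: 3-connected induced subgraphs receive `suc l` colours and `G` is to
-- receive one more.
module Main {n} (G : Graph n) (l : ℕ) (2≤l : 2 ≤ l)
  (colour : ∀ {U} → U ⊆ V G → 3 -Connected (induced G U) → suc l -Colourable (induced G U)) where

  abstract
    clique⇒4≤k : (t : Fin 4 → Fin n) → (∀ i j → i ≢ j → Adj G (t i) (t j)) → 4 ≤ suc l
    clique⇒4≤k t edge = ≮⇒≥ λ lt →
      let f , pf = colourable⇒within G (colour image⊆V (clique-3-connected G t edge))
          i , j , i<j , eq = pigeonhole lt (f ∘ t)
      in pf (∈-image t i) (∈-image t j) (edge i j (<⇒≢ i<j)) eq
      where
      t∈V : ∀ i → t i ∈ V G
      t∈V zero    = adj-∈ G (edge 0F 1F λ ())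
      t∈V (suc i) = adj-∈ G (edge (suc i) 0F λ ())
      image⊆V : image t ⊆ V G
      image⊆V x∈ with i , refl ← image-∈ t x∈ = t∈V i

  open Flexibility G (suc l) (s≤s 2≤l) clique⇒4≤k

  -- The extra colour is reserved for both vertices in `same`, for `x` alone in `apart`, and for `x`
  -- and `y` in `twoTone`, leaving `z` alone.
  flexible-base : ∀ {U} → suc l -Colourable (induced G U) → Flexible U
  flexible-base {U} col = record
    { same = λ {x} {y} _ _ ¬xy → mark x y f , mark-proper x y f G ¬xy pf ,
        trans (hit₁ x y) (sym (mark-hit x y f (inj₂ refl)))
    ; apart = λ {x} {y} {z} _ _ _ x≢y x≢z → mark x x f , mark-proper x x f G (irrefl G refl) pf ,
        (λ eq → miss (≢-sym x≢y) (≢-sym x≢y) (trans (sym eq) (hit₁ x x))) ,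
        (λ eq → miss (≢-sym x≢z) (≢-sym x≢z) (trans (sym eq) (hit₁ x x)))
    ; twoTone = λ {x} {y} {z} _ _ _ xy xz yz →
        mark x y f , mark-proper x y f G (nonadj xy) pf ,
        lone₃ (trans (hit₁ x y) (sym (mark-hit x y f (inj₂ refl))))
          (λ eq → miss (≢-sym (distinct xz)) (≢-sym (distinct yz)) (trans eq (hit₁ x y)))
    }
    where
    open Independent
    f : Fin n → Fin (suc l)
    f = proj₁ (colourable⇒within G col)
    pf : ProperWithin G U f
    pf = proj₂ (colourable⇒within G col)
    hit₁ : ∀ s t → mark s t f s ≡ zero
    hit₁ s t = mark-hit s t f (inj₁ refl)
    miss : ∀ {s t x} → x ≢ s → x ≢ t → mark s t f x ≢ zero
    miss {s} {t} = mark-miss s t f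

  -- The sides are `S` and its complement within `U`, each with `p` and `q` added. The first misses
  -- `b` and the second misses `a`, so both are strictly smaller than `U`.
  gluing : ∀ {X U} (sp : Split (induced G U ∖ X)) → CutPair X U (Split.a sp) (Split.b sp) →
           (∀ {W} → W ⊂ U → Flexible W) → Gluing U
  gluing {X} {U} sp cp flex = record
    { A = side S ; B = side (∁ S) ; p = p ; q = q
    ; p∈A = cut-∈ S p∈U (inj₁ refl) ; q∈A = cut-∈ S q∈U (inj₂ refl)
    ; p∈B = cut-∈ (∁ S) p∈U (inj₁ refl) ; q∈B = cut-∈ (∁ S) q∈U (inj₂ refl)
    ; p≢q = p≢q ; cover = cover ; common = common ; separated = separated
    ; flexA = flex (side⊆U S , b , p─q⊆p U X b∈V , λ b∈ → [ b∉S , [ b≢p , b≢q ]′ ]′ (side-∈ S b∈))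
    ; flexB = flex (side⊆U (∁ S) , a , p─q⊆p U X a∈V ,
                    λ a∈ → [ flip x∈∁p⇒x∉p a∈S , [ a≢p , a≢q ]′ ]′ (side-∈ (∁ S) a∈)) }
    where
    open Split sp
    open CutPair cp
    open Side U p q

    cover : ∀ {x} → x ∈ U → x ∈ side S ⊎ x ∈ side (∁ S)
    cover {x} x∈U with x ∈? S
    ... | yes x∈S = inj₁ (rest-∈ S x∈U x∈S)
    ... | no  x∉S = inj₂ (rest-∈ (∁ S) x∈U (x∉p⇒x∈∁p x∉S))

    common : ∀ {x} → x ∈ side S → x ∈ side (∁ S) → x ≡ p ⊎ x ≡ q
    common x∈A x∈B with side-∈ S x∈A | side-∈ (∁ S) x∈B
    ... | inj₂ cut | _        = cut
    ... | inj₁ _   | inj₂ cut = cut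
    ... | inj₁ x∈S | inj₁ x∈∁S = contradiction x∈S (x∈∁p⇒x∉p x∈∁S)

    -- `S` is closed under adjacency only after `X` is removed, so an edge leaving `S` meets `X`,
    -- whose vertices belong to both sides.
    separated : ∀ {x y} → x ∈ side S → y ∈ side (∁ S) → Adj G x y → y ∈ side S ⊎ x ∈ side (∁ S)
    separated {x} {y} x∈A y∈B xy with side-∈ S x∈A | side-∈ (∁ S) y∈B | x ∈? X | y ∈? X
    ... | inj₂ cut | _ | _ | _ = inj₂ (cut-∈ (∁ S) (side⊆U S x∈A) cut)
    ... | _ | inj₂ cut | _ | _ = inj₁ (cut-∈ S (side⊆U (∁ S) y∈B) cut)
    ... | _ | _ | yes x∈X | _ = inj₂ (cut-∈ (∁ S) (side⊆U S x∈A) (X⊆pq x∈X))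
    ... | _ | _ | _ | yes y∈X = inj₁ (cut-∈ S (side⊆U (∁ S) y∈B) (X⊆pq y∈X))
    ... | inj₁ x∈S | inj₁ y∈∁S | no x∉X | no y∉X =
      contradiction (closed ((side⊆U S x∈A , side⊆U (∁ S) y∈B , xy) , x∉X , y∉X) x∈S)
                    (x∈∁p⇒x∉p y∈∁S)

  flexible : ∀ {U} → U ⊆ V G → Acc _⊂_ U → Flexible U
  flexible {U} U⊆V (acc rs) with 3 <? ∣ U ∣ | smallCutset? (induced G U) 3
  -- At most three vertices can all be coloured differently, since `suc l` is at least 3.
  ... | no  ≯3 | _ = flexible-base (small-colourable (induced G U) (ℕ.≤-trans (≮⇒≥ ≯3) (s≤s 2≤l)))
  ... | yes 3< | no none = flexible-base (colour U⊆V (3< , none))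
  ... | yes 3< | yes (X , (X⊆U , ¬conn) , ∣X∣<3) with connected-or-split (induced G U ∖ X)
  ...   | inj₁ conn = contradiction (λ {x} {y} → conn {x} {y}) ¬conn
  ...   | inj₂ sp = flexible-glued (gluing sp
    (cutPair X U X⊆U ∣X∣<3 3< (∈─⇒∉ U X (Split.a∈V sp)) (∈─⇒∉ U X (Split.b∈V sp)))
    λ W⊂U → flexible (U⊆V ∘ proj₁ W⊂U) (rs W⊂U))

  colourable : suc (suc l) -Colourable G
  colourable with nonempty? (V G)
  ... | yes (x , x∈V) =
    -- A vertex compared with itself extracts a bare proper colouring; this needs some vertex, hence
    -- the separate empty case.
    let _ , pf , _ = Flexible.same (flexible id (⊂-wellFounded (V G))) x∈V x∈V (irrefl G refl)
    in within⇒colourable G pf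
  ... | no empty = (λ v → contradiction v empty) , λ u → contradiction u empty

-- Searching the finitely many induced subgraphs makes the argument constructive. If every
-- 3-connected one is colourable with `m` minus one colours, then `G` is `m`-colourable, against its
-- chromatic number.
subgraph-of-large-χ : ∀ m → m ≥ 4 → (G : Graph n) → χ G ≥ m + 1 →
                      ∃[ H ] H ⊑ G × 3 -Connected H × χ H ≥ m
subgraph-of-large-χ (suc (suc l)) (s≤s (s≤s 2≤l)) G χ>m
  with anySubset? (λ U → (U ⊆? V G) ×-dec
         ((3 -connected? induced G U) ×-dec ¬? (colourable? (induced G U) (suc l))))
... | yes (U , U⊆V , conn , ¬col) =
  induced G U , induced-⊑ G U⊆V , conn , ¬colourable⇒<χ (induced G U) ¬col
... | no  none = contradiction (subst (_≤ χ G) (ℕ.+-comm (suc (suc l)) 1) χ>m)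
  (ℕ.≤⇒≯ (colourable⇒χ≤ G (Main.colourable G l 2≤l λ {U} U⊆V conn →
    decidable-stable (colourable? (induced G U) (suc l)) λ ¬col → none (U , U⊆V , conn , ¬col))))

-- A graph that is not 4-colourable has chromatic number at least 5, so the case of `m` equal to 4
-- yields a 3-connected subgraph.
fragile⇒4-colourable : (G : Graph n) → Fragile G → 4 -Colourable G
fragile⇒4-colourable G fragile = decidable-stable (colourable? G 4) λ ¬col →
  let H , H⊑G , conn , _ = subgraph-of-large-χ 4 ℕ.≤-refl G (¬colourable⇒<χ G ¬col)
  in fragile (H , H⊑G , conn)

theorem2 : (∀ (m : ℕ) → m ≥ 4 → ∀ {n : ℕ} (G : Graph n) → χ G ≥ m + 1 →
    ∃[ H ] H ⊑ G × 3 -Connected H × χ H ≥ m)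
    × (∀ {n : ℕ} (G : Graph n) → Fragile G → 4 -Colourable G)
theorem2 = (λ m m≥4 G → subgraph-of-large-χ m m≥4 G) , fragile⇒4-colourable
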